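{- A 2-Star Nim position $([a_1],[a_2])$ is a $\mathcal{P}$-position if and only if either $a_1+a_2=1$ or $a_1=a_2\ge 2$.
   Context: $m$-Star Nim: $m$ strips of squares numbered $0,1,2,\ldots$ share their square $0$; each strip carries one token, and the shared square $0$ holds at most one token. A position is a tuple $([a_1],\ldots,[a_m])$ of nonnegative integers with at most one $a_i$ equal to $0$. A move replaces exactly one $a_i$ by a smaller nonnegative integer, provided the result is a legal position (so $a_i$ may be replaced by $0$ only if no other token is on square $0$). The game is impartial and a player unable to move loses. A $\mathcal{P}$-position is one from which the player about to move has no winning strategy; equivalently, its Sprague-Grundy value is $0$. -}

module Defs where

open import Data.Fin using (Fin)
open import Data.Nat using (ℕ; _<_)
open import Data.Product using (Σ-syntax; _×_)
open import Data.Vec using (Vec; lookup; _[_]≔_)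
open import Level using (Level; _⊔_)
open import Relation.Binary.Core using (Rel)
open import Relation.Binary.PropositionalEquality using (_≡_)
open import Relation.Nullary using (¬_)

private
  variable
    a ℓ : Level
    m : ℕ

-- Normal play for an impartial game given by its move relation.  A winning
-- strategy for the player about to move is a choice of move together with a
-- winning strategy after each reply of the opponent; if the opponent has no
-- reply, the game is won.  The strategy being inductive, every play following
-- it is finite.
data WinningStrategy {P : Set a} (_⟶_ : Rel P ℓ) (p : P) : Set (a ⊔ ℓ) where
  play : ∀ {q} → p ⟶ q → (∀ {r} → q ⟶ r → WinningStrategy _⟶_ r) →
         WinningStrategy _⟶_ p

PPosition : {P : Set a} → Rel P ℓ → P → Set (a ⊔ ℓ)
PPosition _⟶_ p = ¬ WinningStrategy _⟶_ p

AtMostOneZero : Vec ℕ m → Set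
AtMostOneZero as = ∀ i j → lookup as i ≡ 0 → lookup as j ≡ 0 → i ≡ j

record Position (m : ℕ) : Set where
  constructor ⟨_,_⟩
  field
    tokens : Vec ℕ m
    legal  : AtMostOneZero tokens

open Position public

-- The result of a move is a `Position`, hence automatically legal.
StarNimMove : Rel (Position m) _
StarNimMove {m} p q =
  Σ[ i ∈ Fin m ] Σ[ b ∈ ℕ ] b < lookup (tokens p) i × tokens q ≡ tokens p [ i ]≔ b

{-# OPTIONS --safe #-}

-- The positions of the claimed form are a kernel of the move graph: no move
-- joins two of them, because either coordinate determines the other, and every
-- other position has a move to one of them.  In a terminating game a kernel
-- consists exactly of the 𝒫-positions.

module Submission where

open import Data.Nat using (ℕ; _+_; _≥_)
open import Data.Product using (_×_)
open import Data.Sum using (_⊎_)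
open import Data.Vec using ([]; _∷_)
open import Function.Bundles using (_⇔_)
open import Relation.Binary.PropositionalEquality using (_≡_)
open import Defs

open import Data.Empty using (⊥-elim)
open import Data.Fin using (zero; suc)
open import Data.Nat using (zero; suc; _<_; z≤n; s≤s; z<s; s<s)
open import Data.Nat.Induction using (<-wellFounded)
open import Data.Nat.Properties
  using (+-cancelʳ-≡; +-comm; +-monoˡ-<; +-monoʳ-<; <-cmp; <⇒≱; <-irrefl; m≤n+m; ≤-trans; ≤-reflexive)
open import Data.Product using (∃-syntax; _,_)
open import Data.Sum using (inj₁; inj₂)
open import Data.Vec using (Vec; lookup; sum; _[_]≔_)
open import Function.Base using (flip; _on_)
open import Function.Bundles using (mk⇔)
open import Induction.WellFounded using (WellFounded; Acc; acc; module Subrelation)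
open import Relation.Binary.Construct.On using () renaming (wellFounded to on-wellFounded)
open import Relation.Binary.Core using (Rel)
open import Relation.Binary.Definitions using (tri<; tri≈; tri>)
open import Relation.Binary.PropositionalEquality using (refl; sym; trans)
open import Relation.Nullary using (¬_)

module Kernel {a ℓ k} {P : Set a} {_⟶_ : Rel P ℓ} (K : P → Set k)
  (independent : ∀ {p q} → K p → p ⟶ q → ¬ K q)
  (absorbing : ∀ p → K p ⊎ ∃[ q ] p ⟶ q × K q)
  where

  -- The opponent answers each move by returning to the kernel. The recursion descends through the
  -- supposed winning strategy, which is inductive and so cannot last forever.
  kernel⇒PPosition : ∀ {p} → K p → PPosition _⟶_ p
  kernel⇒PPosition Kp (play {q} p⟶q reply) with absorbing q
  ... | inj₁ Kq             = independent Kp p⟶q Kq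
  ... | inj₂ (_ , q⟶r , Kr) = kernel⇒PPosition Kr (reply q⟶r)

  module _ (⟵-wellFounded : WellFounded (flip _⟶_)) where

    ¬kernel⇒winning : ∀ p → ¬ K p → WinningStrategy _⟶_ p
    ¬kernel⇒winning p = go p (⟵-wellFounded p)
      where
      go : ∀ p → Acc (flip _⟶_) p → ¬ K p → WinningStrategy _⟶_ p
      go p (acc rs) ¬Kp with absorbing p
      ... | inj₁ Kp = ⊥-elim (¬Kp Kp)
      ... | inj₂ (q , p⟶q , Kq) with rs p⟶q
      -- A round is two moves, hence two layers of accessibility: `rs` for the move into the kernel,
      -- `rs′` for the reply, which must leave it again.
      ...   | acc rs′ = play p⟶q λ {r} q⟶r → go r (rs′ q⟶r) (independent Kq q⟶r)

    -- Constructive because `absorbing` decides membership in `K`: a move into the kernel shows, by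
    -- independence, that `p` lies outside it.
    PPosition⇒kernel : ∀ {p} → PPosition _⟶_ p → K p
    PPosition⇒kernel {p} ¬win with absorbing p
    ... | inj₁ Kp               = Kp
    ... | inj₂ (_ , p⟶q , Kq) =
      ⊥-elim (¬win (¬kernel⇒winning p λ Kp → independent Kp p⟶q Kq))

    PPosition⇔kernel : ∀ {p} → PPosition _⟶_ p ⇔ K p
    PPosition⇔kernel = mk⇔ PPosition⇒kernel kernel⇒PPosition

sum-[]≔-< : ∀ {m} (xs : Vec ℕ m) i {b} → b < lookup xs i → sum (xs [ i ]≔ b) < sum xs
sum-[]≔-< (x ∷ xs) zero    b<x = +-monoˡ-< (sum xs) b<x
sum-[]≔-< (x ∷ xs) (suc i) b<  = +-monoʳ-< x (sum-[]≔-< xs i b<)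

-- The sum of all coordinates is the termination measure.
StarNim-wellFounded : ∀ {m} → WellFounded (flip (StarNimMove {m}))
StarNim-wellFounded {m} = Subrelation.wellFounded (λ {q} {p} → move⇒sum-< {q} {p})
  (on-wellFounded (λ p → sum (tokens p)) <-wellFounded)
  where
  move⇒sum-< : ∀ {q p : Position m} → StarNimMove p q → (_<_ on λ r → sum (tokens r)) q p
  move⇒sum-< {_} {p} (i , _ , b< , refl) = sum-[]≔-< (tokens p) i b<

Cold : ℕ → ℕ → Set
Cold a b = a + b ≡ 1 ⊎ (a ≡ b × b ≥ 2)

Cold-sym : ∀ {a b} → Cold a b → Cold b a
Cold-sym {a} {b} (inj₁ a+b≡1)      = inj₁ (trans (+-comm b a) a+b≡1)
Cold-sym         (inj₂ (refl , b≥2)) = inj₂ (refl , b≥2)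

-- The shared entry `c` fixes the alternative: it is at most 1 in the first and at least 2 in the
-- second, so the mixed cases are contradictory.
Cold-functional : ∀ {a b c} → Cold a c → Cold b c → a ≡ b
Cold-functional {a} {b} {c} (inj₁ p) (inj₁ q) = +-cancelʳ-≡ c a b (trans p (sym q))
Cold-functional {a} {b} {c} (inj₁ p) (inj₂ (_ , c≥2)) =
  ⊥-elim (<⇒≱ c≥2 (≤-trans (m≤n+m c a) (≤-reflexive p)))
Cold-functional (inj₂ p) (inj₁ q) = sym (Cold-functional (inj₁ q) (inj₂ p))
Cold-functional (inj₂ (p , _)) (inj₂ (q , _)) = trans p (sym q)

¬Cold-0-0 : ¬ Cold 0 0
¬Cold-0-0 (inj₁ ())
¬Cold-0-0 (inj₂ (_ , ()))

ColdPosition : Position 2 → Set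
ColdPosition ⟨ a ∷ b ∷ [] , _ ⟩ = Cold a b

-- Makes every move to a cold pair legal automatically: the only illegal pair, two zeros, is not
-- cold.
Cold⇒legal : ∀ {a b} → Cold a b → AtMostOneZero (a ∷ b ∷ [])
Cold⇒legal cold zero       zero       _    _    = refl
Cold⇒legal cold zero       (suc zero) refl refl = ⊥-elim (¬Cold-0-0 cold)
Cold⇒legal cold (suc zero) zero       refl refl = ⊥-elim (¬Cold-0-0 cold)
Cold⇒legal cold (suc zero) (suc zero) _    _    = refl

Cold-independent : ∀ {p q} → ColdPosition p → StarNimMove p q → ¬ ColdPosition q
Cold-independent {⟨ a ∷ b ∷ [] , _ ⟩} cold (zero , c , c<a , refl) cold′ =
  <-irrefl (Cold-functional cold′ cold) c<a
Cold-independent {⟨ a ∷ b ∷ [] , _ ⟩} cold (suc zero , c , c<b , refl) cold′ =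
  -- Here the first entry is the untouched one, so both pairs are swapped.
  <-irrefl (Cold-functional (Cold-sym cold′) (Cold-sym cold)) c<b

module _ {a b} (legal : AtMostOneZero (a ∷ b ∷ [])) where

  ColdMove : Set
  ColdMove = ∃[ q ] StarNimMove ⟨ a ∷ b ∷ [] , legal ⟩ q × ColdPosition q

  moveFirst : ∀ {c} → c < a → Cold c b → ColdMove
  moveFirst c<a cold = ⟨ _ , Cold⇒legal cold ⟩ , (zero , _ , c<a , refl) , cold

  moveSecond : ∀ {c} → c < b → Cold a c → ColdMove
  moveSecond c<b cold = ⟨ _ , Cold⇒legal cold ⟩ , (suc zero , _ , c<b , refl) , cold

Cold-absorbing : ∀ p → ColdPosition p ⊎ ∃[ q ] StarNimMove p q × ColdPosition q
Cold-absorbing ⟨ 0 ∷ 0 ∷ [] , legal ⟩ with () ← legal zero (suc zero) refl refl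
Cold-absorbing ⟨ 0 ∷ 1 ∷ [] , _ ⟩ = inj₁ (inj₁ refl)
Cold-absorbing ⟨ 1 ∷ 0 ∷ [] , _ ⟩ = inj₁ (inj₁ refl)
-- Square 0 is occupied, so the other token stops at 1.
Cold-absorbing ⟨ 0 ∷ suc (suc _) ∷ [] , legal ⟩ = inj₂ (moveSecond legal (s<s z<s) (inj₁ refl))
Cold-absorbing ⟨ suc (suc _) ∷ 0 ∷ [] , legal ⟩ = inj₂ (moveFirst legal (s<s z<s) (inj₁ refl))
-- Square 0 is free and one token is on 1, so the other goes to 0; this includes the equal pair of
-- ones.
Cold-absorbing ⟨ 1 ∷ suc _ ∷ [] , legal ⟩ = inj₂ (moveSecond legal z<s (inj₁ refl))
Cold-absorbing ⟨ suc (suc _) ∷ 1 ∷ [] , legal ⟩ = inj₂ (moveFirst legal z<s (inj₁ refl))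
-- Both entries are at least 2: as in two-heap Nim, the larger is lowered to the smaller.
Cold-absorbing ⟨ a@(suc (suc _)) ∷ b@(suc (suc _)) ∷ [] , legal ⟩ with <-cmp a b
... | tri< a<b _ _ = inj₂ (moveSecond legal a<b (inj₂ (refl , s≤s (s≤s z≤n))))
... | tri≈ _ a≡b _ = inj₁ (inj₂ (a≡b , s≤s (s≤s z≤n)))
... | tri> _ _ b<a = inj₂ (moveFirst legal b<a (inj₂ (refl , s≤s (s≤s z≤n))))

proposition1 : (a₁ a₂ : ℕ) (legal : AtMostOneZero (a₁ ∷ a₂ ∷ [])) →
    PPosition StarNimMove ⟨ a₁ ∷ a₂ ∷ [] , legal ⟩ ⇔ (a₁ + a₂ ≡ 1 ⊎ (a₁ ≡ a₂ × a₂ ≥ 2))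
proposition1 a₁ a₂ legal =
  Kernel.PPosition⇔kernel ColdPosition Cold-independent Cold-absorbing StarNim-wellFounded
    {⟨ a₁ ∷ a₂ ∷ [] , legal ⟩}
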